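{- Let $n\ge 1$ and let $G$ be a unit rectangle visibility graph with $n$ vertices. Then $$|E(G)|\le 6n-4\lceil\sqrt{n}\,\rceil+1.$$
   Context: A finite simple graph $G$ is a unit rectangle visibility graph (URVG) if its vertices $v$ can be represented by closed unit squares $S_v$ in the plane with sides parallel to the coordinate axes and with pairwise disjoint interiors (squares may touch along their boundaries), in such a way that two distinct vertices $v,w$ are adjacent if and only if there is an unobstructed non-degenerate (positive width) horizontal or vertical band of visibility joining $S_v$ and $S_w$. Here a horizontal band of visibility joining $S_v$ and $S_w$ is given by an open interval $I$ of positive length such that for every $y_0\in I$ the line $y=y_0$ meets the interiors of both $S_v$ and $S_w$, and the part of this line between $S_v$ and $S_w$ (possibly a single point if the squares touch) meets the interior of no other square of the representation; vertical bands are defined analogously with the roles of $x$ and $y$ exchanged. -}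

module Defs where

open import Data.Empty using (⊥)
open import Data.Fin using (Fin; _<?_)
open import Data.List using (List; length; filter; allFin; cartesianProduct)
open import Data.Nat as ℕ using (ℕ; zero; suc; z≤n)
import Data.Nat.Properties as ℕₚ
open import Data.Product using (Σ; ∃; ∃-syntax; _×_; _,_; proj₁; proj₂; swap)
open import Data.Rational as ℚ using (ℚ; 1ℚ)
import Data.Rational.Properties as ℚₚ
open import Data.Sum using (_⊎_; inj₁; inj₂)
open import Function using (_⇔_; _∘_)
open import Relation.Binary using (Decidable; Symmetric; Irreflexive)
open import Relation.Binary.PropositionalEquality
open import Relation.Nullary using (¬_; yes; no; contradiction)
open import Relation.Nullary.Decidable using (_×-dec_)

------------------------------------------------------------------------
-- Real numbers as two-sided Dedekind cuts of ℚ

record ℝ : Set₁ where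
  field
    L U         : ℚ → Set
    L-inhabited : ∃[ q ] L q
    U-inhabited : ∃[ q ] U q
    L-closed    : ∀ {p q} → p ℚ.< q → L q → L p
    U-closed    : ∀ {p q} → p ℚ.< q → U p → U q
    L-open      : ∀ {p} → L p → ∃[ q ] (p ℚ.< q × L q)
    U-open      : ∀ {q} → U q → ∃[ p ] (p ℚ.< q × U p)
    disjoint    : ∀ {q} → L q → U q → ⊥
    located     : ∀ {p q} → p ℚ.< q → L p ⊎ U q

open ℝ public

infix 4 _<_ _≤_

_<_ : ℝ → ℝ → Set
x < y = ∃[ q ] (U x q × L y q)

_≤_ : ℝ → ℝ → Set
x ≤ y = ¬ (y < x)

private
  q+r-r≡q : ∀ q r → (q ℚ.+ r) ℚ.- r ≡ q
  q+r-r≡q q r = trans (ℚₚ.+-assoc q r (ℚ.- r))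
    (trans (cong (q ℚ.+_) (ℚₚ.+-inverseʳ r)) (ℚₚ.+-identityʳ q))

  q-r+r≡q : ∀ q r → (q ℚ.- r) ℚ.+ r ≡ q
  q-r+r≡q q r = trans (ℚₚ.+-assoc q (ℚ.- r) r)
    (trans (cong (q ℚ.+_) (ℚₚ.+-inverseˡ r)) (ℚₚ.+-identityʳ q))

infixl 6 _+ℚ_

-- Only rational translations of reals are needed: q lies below (above) x + r
-- exactly when q - r lies below (above) x.
_+ℚ_ : ℝ → ℚ → ℝ
x +ℚ r = record
  { L = λ q → L x (q ℚ.- r)
  ; U = λ q → U x (q ℚ.- r)
  ; L-inhabited = let q , l = L-inhabited x in
      q ℚ.+ r , subst (L x) (sym (q+r-r≡q q r)) l
  ; U-inhabited = let q , u = U-inhabited x in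
      q ℚ.+ r , subst (U x) (sym (q+r-r≡q q r)) u
  ; L-closed = λ p<q → L-closed x (ℚₚ.+-monoˡ-< (ℚ.- r) p<q)
  ; U-closed = λ p<q → U-closed x (ℚₚ.+-monoˡ-< (ℚ.- r) p<q)
  ; L-open = λ {p} l → let q , p-r<q , l′ = L-open x l in
      q ℚ.+ r
      , subst (ℚ._< q ℚ.+ r) (q-r+r≡q p r) (ℚₚ.+-monoˡ-< r p-r<q)
      , subst (L x) (sym (q+r-r≡q q r)) l′
  ; U-open = λ {q} u → let p , p<q-r , u′ = U-open x u in
      p ℚ.+ r
      , subst (p ℚ.+ r ℚ.<_) (q-r+r≡q q r) (ℚₚ.+-monoˡ-< r p<q-r)
      , subst (U x) (sym (q+r-r≡q p r)) u′
  ; disjoint = disjoint x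
  ; located = λ p<q → located x (ℚₚ.+-monoˡ-< (ℚ.- r) p<q)
  }

------------------------------------------------------------------------
-- Finite simple graphs

-- Adjacency is decidable so that the edges can be counted.
record SimpleGraph (n : ℕ) : Set₁ where
  field
    Adj        : Fin n → Fin n → Set
    Adj?       : Decidable Adj
    Adj-sym    : Symmetric Adj
    Adj-irrefl : Irreflexive _≡_ Adj

open SimpleGraph public

-- The edge {v , w} is listed once, as the pair with v < w.
edges : ∀ {n} → SimpleGraph n → List (Fin n × Fin n)
edges {n} G =
  filter (λ (v , w) → v <? w ×-dec Adj? G v w) (cartesianProduct (allFin n) (allFin n))

∣E_∣ : ∀ {n} → SimpleGraph n → ℕ
∣E G ∣ = length (edges G)

------------------------------------------------------------------------
-- Unit squares and visibility

Point : Set₁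
Point = ℝ × ℝ

-- A closed axis-parallel unit square is given by its lower left corner:
-- (a , b) stands for [a , a + 1] × [b , b + 1].
Square : Set₁
Square = Point

Interior : Square → Point → Set
Interior (a , b) (x , y) = (a < x × x < a +ℚ 1ℚ) × (b < y × y < b +ℚ 1ℚ)

-- On a horizontal line meeting the interiors of two squares with disjoint
-- interiors, the part between them runs from the right side of the left-hand
-- square to the left side of the right-hand one.  It is a single point when
-- the squares touch.
BetweenX : Square → Square → ℝ → Set
BetweenX (a , _) (c , _) x =
  (a +ℚ 1ℚ ≤ x × x ≤ c) ⊎ (c +ℚ 1ℚ ≤ x × x ≤ a)

LineMeetsInterior : ℝ → Square → Set₁
LineMeetsInterior y s = ∃[ x ] Interior s (x , y)

module _ {n : ℕ} (S : Fin n → Square) where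

  DisjointInteriors : Set₁
  DisjointInteriors = ∀ {v w} → v ≢ w → ∀ p → Interior (S v) p → Interior (S w) p → ⊥

  HorizontalBand : Fin n → Fin n → Set₁
  HorizontalBand v w = ∃[ lo ] ∃[ hi ] (lo < hi ×
    (∀ y → lo < y → y < hi →
      LineMeetsInterior y (S v) ×
      LineMeetsInterior y (S w) ×
      (∀ u → u ≢ v → u ≢ w → ∀ x → BetweenX (S v) (S w) x → ¬ Interior (S u) (x , y))))

-- Swapping the coordinates of the corners reflects the squares in the diagonal.
VerticalBand : ∀ {n} → (Fin n → Square) → Fin n → Fin n → Set₁
VerticalBand S = HorizontalBand (swap ∘ S)

Visible : ∀ {n} → (Fin n → Square) → Fin n → Fin n → Set₁
Visible S v w = HorizontalBand S v w ⊎ VerticalBand S v w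

IsURVG : ∀ {n} → SimpleGraph n → Set₁
IsURVG {n} G = Σ (Fin n → Square) λ S →
  DisjointInteriors S × (∀ v w → v ≢ w → Adj G v w ⇔ Visible S v w)

------------------------------------------------------------------------
-- Rounded-up square root

⌈√_⌉ : ℕ → ℕ
⌈√ zero ⌉ = 0
⌈√ suc n ⌉ with suc n ℕ.≤? ⌈√ n ⌉ ℕ.* ⌈√ n ⌉
... | yes _ = ⌈√ n ⌉
... | no  _ = suc ⌈√ n ⌉

-- ⌈√ n ⌉ is the least k with n ≤ k².
⌈√⌉-upper : ∀ n → n ℕ.≤ ⌈√ n ⌉ ℕ.* ⌈√ n ⌉
⌈√⌉-upper zero = z≤n
⌈√⌉-upper (suc n) with suc n ℕ.≤? ⌈√ n ⌉ ℕ.* ⌈√ n ⌉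
... | yes le = le
... | no  _  = ℕ.s≤s (ℕₚ.≤-trans (⌈√⌉-upper n)
  (ℕₚ.≤-trans (ℕₚ.*-monoʳ-≤ ⌈√ n ⌉ (ℕₚ.n≤1+n ⌈√ n ⌉)) (ℕₚ.m≤n+m _ ⌈√ n ⌉)))

⌈√⌉-least : ∀ n k → n ℕ.≤ k ℕ.* k → ⌈√ n ⌉ ℕ.≤ k
⌈√⌉-least zero k _ = z≤n
⌈√⌉-least (suc n) k n<kk with suc n ℕ.≤? ⌈√ n ⌉ ℕ.* ⌈√ n ⌉
... | yes _ = ⌈√⌉-least n k (ℕₚ.<⇒≤ n<kk)
... | no n≮ = ℕₚ.≤∧≢⇒< (⌈√⌉-least n k (ℕₚ.<⇒≤ n<kk))
  λ { refl → contradiction n<kk n≮ }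

{-# OPTIONS --safe #-}

-- Sweep a horizontal line upwards.  The squares it meets are ordered from left to
-- right, two squares see each other horizontally exactly while they are adjacent
-- in this order, and new adjacencies appear only when a square is born (at most
-- two) or dies (at most one).  So each horizontal edge is charged to one of 3n
-- slots.  A slot is lost whenever a square is born or dies at the left or right
-- end of the order.  As the squares have the same height, they die in the order
-- in which they are born, hence between the birth and the death of any square
-- something is lost at the left end and something at the right end.  If a is the
-- largest number of squares lying strictly above each other, this loses 2a slots,
-- and the left end of the first birth is one more.  So there are at most
-- 3n - 2a - 1 horizontal edges and, with b the largest number of squares lying
-- strictly beside each other, at most 3n - 2b - 1 vertical ones.  Finally n ≤ ab:
-- a square is determined by the lengths of the longest chains ending in it, one
-- upwards and one to the right; so a + b ≥ 2⌈√n⌉ - 1.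
--
-- The bound is a decidable statement, so the finitely many comparisons of
-- coordinates may be decided classically.
module Submission where

open import Defs
open import Data.Nat using (ℕ; zero; suc)
open import Data.Integer using (+_; _+_; _-_; _*_)
import Data.Nat as ℕ
import Data.Integer as ℤ
open import Data.Empty using (⊥; ⊥-elim)
open import Data.Fin as Fin using (Fin)
import Data.Fin.Induction as Fin
open import Data.Fin.Patterns using (0F; 1F; 2F)
import Data.Fin.Properties as Finₚ
import Data.Integer.Properties as ℤₚ
open import Data.List using (List; []; _∷_; _++_; length; lookup; allFin; cartesianProduct)
open import Data.List.Membership.Propositional using (_∈_)
open import Data.List.Membership.Propositional.Properties using (∈-lookup; ∈-++⁻)
import Data.List.Properties as Listₚ
open import Data.List.Relation.Unary.All as All using (All; []; _∷_)
import Data.List.Relation.Unary.All.Properties as Allₚ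
open import Data.List.Relation.Unary.AllPairs as AllPairs using (AllPairs; []; _∷_)
open import Data.List.Relation.Unary.Any using (here; there)
open import Data.List.Relation.Unary.Unique.Propositional using (Unique)
import Data.List.Relation.Unary.Unique.Propositional.Properties as Uniqueₚ
import Data.Nat.Properties as ℕₚ
open import Data.Nat.Tactic.RingSolver using (solve-∀)
open import Data.Product using (∃; _×_; _,_; proj₁; proj₂; swap)
open import Data.Rational as ℚ using (ℚ; 1ℚ)
open import Data.Rational.Literals using (fromℤ)
import Data.Rational.Properties as ℚₚ
import Data.Rational.Unnormalised as ℚᵘ
import Data.Rational.Unnormalised.Properties as ℚᵘₚ
open import Data.Sum as Sum using (_⊎_; inj₁; inj₂; [_,_]′)
open import Data.Unit using (⊤; tt)
open import Effect.Monad using (RawMonad)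
open import Function using (_∘_; flip; id; Equivalence)
open import Function.Definitions using (Injective)
open import Induction.WellFounded using (Acc; acc)
open import Level using (0ℓ)
open import Relation.Binary
  using (Rel; Decidable; Transitive; Trichotomous; tri<; tri≈; tri>; IsStrictPartialOrder; IsStrictTotalOrder)
import Relation.Binary.Construct.Flip.EqAndOrd as Flip
open import Relation.Binary.PropositionalEquality
open import Relation.Binary.Structures.Biased using (isStrictTotalOrderᶜ)
open import Relation.Nullary using (¬_; contradiction; yes; no; Dec)
open import Relation.Nullary.Decidable using (_×-dec_; _⊎-dec_; ¬?; decidable-stable; ¬¬-excluded-middle)
open import Relation.Nullary.Negation using (¬¬-Monad)
import Relation.Unary as Unary

-- Order properties of Dedekind reals.

below-above : ∀ x {p q} → L x p → U x q → p ℚ.< q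
below-above x {p} {q} Lp Uq with ℚₚ.<-cmp p q
... | tri< p<q _ _ = p<q
... | tri≈ _ refl _ = contradiction Uq (disjoint x Lp)
... | tri> _ _ q<p = contradiction Uq (disjoint x (L-closed x q<p Lp))

<-irrefl : ∀ x → ¬ (x < x)
<-irrefl x (q , Ux , Lx) = disjoint x Lx Ux

<-trans : ∀ x y z → x < y → y < z → x < z
<-trans x y z (q , Ux , Ly) (r , Uy , Lz) = r , U-closed x (below-above y Ly Uy) Ux , Lz

<⇒≤ : ∀ x y → x < y → x ≤ y
<⇒≤ x y x<y y<x = <-irrefl x (<-trans x y x x<y y<x)

-- As `≤` is a negation, a rational witness must be produced: openness of the upper cut of `y` opens
-- a gap below `q`, and locatedness of `x` in this gap decides.
≤-<-trans : ∀ x y z → x ≤ y → y < z → x < z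
≤-<-trans x y z x≤y (q , Uy , Lz) with U-open y Uy
... | p , p<q , Uy′ with located x p<q
... | inj₁ Lx = contradiction (p , Uy′ , Lx) x≤y
... | inj₂ Ux = q , Ux , Lz

<-≤-trans : ∀ x y z → x < y → y ≤ z → x < z
<-≤-trans x y z (q , Ux , Ly) y≤z with L-open y Ly
... | r , q<r , Ly′ with located z q<r
... | inj₁ Lz = q , Ux , Lz
... | inj₂ Uz = contradiction (r , Uz , Ly′) y≤z

≤-trans : ∀ x y z → x ≤ y → y ≤ z → x ≤ z
≤-trans x y z x≤y y≤z z<x = x≤y (≤-<-trans y z x y≤z z<x)

+1-mono-≤ : ∀ x y → x ≤ y → x +ℚ 1ℚ ≤ y +ℚ 1ℚ
+1-mono-≤ x y x≤y (q , Uy , Lx) = x≤y (q ℚ.- 1ℚ , Uy , Lx)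

p-1<p : ∀ p → p ℚ.- 1ℚ ℚ.< p
p-1<p p = subst (p ℚ.- 1ℚ ℚ.<_) (ℚₚ.+-identityʳ p)
  (ℚₚ.+-monoʳ-< p (ℚ.*<* ℤ.-<+))

p<p+1 : ∀ p → p ℚ.< p ℚ.+ 1ℚ
p<p+1 p = subst (ℚ._< p ℚ.+ 1ℚ) (ℚₚ.+-identityʳ p)
  (ℚₚ.+-monoʳ-< p (ℚ.*<* (ℤ.+<+ (ℕ.s≤s ℕ.z≤n))))

p+1-1≡p : ∀ p → (p ℚ.+ 1ℚ) ℚ.- 1ℚ ≡ p
p+1-1≡p p = trans (ℚₚ.+-assoc p 1ℚ (ℚ.- 1ℚ)) (ℚₚ.+-identityʳ p)

p-1+1≡p : ∀ p → (p ℚ.- 1ℚ) ℚ.+ 1ℚ ≡ p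
p-1+1≡p p = trans (ℚₚ.+-assoc p (ℚ.- 1ℚ) 1ℚ) (ℚₚ.+-identityʳ p)

fromℤ-suc : ∀ n → fromℤ (+ suc n) ≡ fromℤ (+ n) ℚ.+ 1ℚ
fromℤ-suc n = ℚₚ.toℚᵘ-injective (ℚᵘₚ.≃-trans
  (ℚᵘ.*≡* (cong (_* + 1) (trans (cong +_ (ℕₚ.+-comm 1 n)) (cong (_+ + 1) (sym (ℤₚ.*-identityʳ (+ n)))))))
  (ℚᵘₚ.≃-sym (ℚₚ.toℚᵘ-homo-+ (fromℤ (+ n)) 1ℚ)))

archimedean : ∀ p → ∃ λ n → p ℚ.< fromℤ (+ n)
archimedean (ℚ.mkℚ (+ a) d _) = suc a , ℚ.*<* (subst₂ ℤ._<_
  (sym (ℤₚ.*-identityʳ (+ a))) (ℤₚ.pos-* (suc a) (suc d)) (ℤ.+<+ (ℕₚ.m≤m*n (suc a) (suc d))))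
archimedean (ℚ.mkℚ ℤ.-[1+ a ] d _) = 0 , ℚ.*<* ℤ.-<+

-- If x + 1 ≤ x, then L x would be closed under adding 1, hence all of ℚ.
x+1≰x : ∀ x → ¬ (x +ℚ 1ℚ ≤ x)
x+1≰x x x+1≤x = disjoint x (everything-below (proj₁ reach) (proj₂ reach)) Uu
  where
  l = proj₁ (L-inhabited x)
  Ll = proj₂ (L-inhabited x)
  u = proj₁ (U-inhabited x)
  Uu = proj₂ (U-inhabited x)
  everything-below : ∀ n {q} → q ℚ.< l ℚ.+ fromℤ (+ n) → L x q
  everything-below zero q<l = L-closed x (subst (_ ℚ.<_) (ℚₚ.+-identityʳ l) q<l) Ll
  everything-below (suc n) {q} q<l+n+1 with ℚₚ.<-dense q-1<l+n
    where
    q-1<l+n : q ℚ.- 1ℚ ℚ.< l ℚ.+ fromℤ (+ n)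
    q-1<l+n = subst (q ℚ.- 1ℚ ℚ.<_)
      (trans (cong (λ r → (l ℚ.+ r) ℚ.- 1ℚ) (fromℤ-suc n))
        (trans (cong (ℚ._- 1ℚ) (sym (ℚₚ.+-assoc l (fromℤ (+ n)) 1ℚ))) (p+1-1≡p _)))
      (ℚₚ.+-monoˡ-< (ℚ.- 1ℚ) q<l+n+1)
  ... | r , q-1<r , r<l+n with located x (subst (ℚ._< r ℚ.+ 1ℚ) (p-1+1≡p q) (ℚₚ.+-monoˡ-< 1ℚ q-1<r))
  ... | inj₁ Lq = Lq
  ... | inj₂ Ur+1 = contradiction
    (r ℚ.+ 1ℚ , Ur+1 , subst (L x) (sym (p+1-1≡p r)) (everything-below n r<l+n)) x+1≤x
  reach : ∃ λ n → u ℚ.< l ℚ.+ fromℤ (+ n)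
  reach with archimedean (u ℚ.- l)
  ... | n , u-l<n = n , subst (ℚ._< l ℚ.+ fromℤ (+ n)) l+[u-l]≡u (ℚₚ.+-monoʳ-< l u-l<n)
    where
    l+[u-l]≡u : l ℚ.+ (u ℚ.- l) ≡ u
    l+[u-l]≡u = trans (ℚₚ.+-comm l _) (trans (ℚₚ.+-assoc u (ℚ.- l) l)
      (trans (cong (u ℚ.+_) (ℚₚ.+-inverseˡ l)) (ℚₚ.+-identityʳ u)))

fromℚ : ℚ → ℝ
fromℚ q = record
  { L = ℚ._< q
  ; U = q ℚ.<_
  ; L-inhabited = q ℚ.- 1ℚ , p-1<p q
  ; U-inhabited = q ℚ.+ 1ℚ , p<p+1 q
  ; L-closed = ℚₚ.<-trans
  ; U-closed = λ p<r q<p → ℚₚ.<-trans q<p p<r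
  ; L-open = λ p<q → let r , p<r , r<q = ℚₚ.<-dense p<q in r , p<r , r<q
  ; U-open = λ q<p → let r , q<r , r<p = ℚₚ.<-dense q<p in r , r<p , q<r
  ; disjoint = ℚₚ.<-asym
  ; located = located-at
  }
  where
  located-at : ∀ {p r} → p ℚ.< r → p ℚ.< q ⊎ q ℚ.< r
  located-at {p} p<r with ℚₚ.<-cmp p q
  ... | tri< p<q _ _ = inj₁ p<q
  ... | tri≈ _ refl _ = inj₂ p<r
  ... | tri> _ _ q<p = inj₂ (ℚₚ.<-trans q<p p<r)

<-dense : ∀ x y → x < y → ∃ λ z → x < z × z < y
<-dense x y (q , Ux , Ly) =
  let p , p<q , Ux′ = U-open x Ux
      r , q<r , Ly′ = L-open y Ly
  in fromℚ q , (p , Ux′ , p<q) , (r , q<r , Ly′)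

InUnitInterval : ℝ → ℝ → Set
InUnitInterval x z = x < z × z < x +ℚ 1ℚ

-- The common point lies between the larger left end and the smaller right end. Which of `x` and `y`
-- is larger cannot be decided, hence the double negation.
overlapping-unit-intervals : ∀ x y → ¬ (x +ℚ 1ℚ ≤ y) → ¬ (y +ℚ 1ℚ ≤ x) →
  ¬ ¬ (∃ λ z → InUnitInterval x z × InUnitInterval y z)
overlapping-unit-intervals x y x+1≰y y+1≰x none =
  y+1≰x λ x<y+1 → x+1≰y λ y<x+1 →
  let x≤y : x ≤ y
      x≤y y<x = let z , x<z , z<y+1 = <-dense x (y +ℚ 1ℚ) x<y+1 in
        none (z , (x<z , <-≤-trans z (y +ℚ 1ℚ) (x +ℚ 1ℚ) z<y+1 (+1-mono-≤ y x (<⇒≤ y x y<x)))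
                , (<-trans y x z y<x x<z , z<y+1))
      z , y<z , z<x+1 = <-dense y (x +ℚ 1ℚ) y<x+1
  in none (z , (≤-<-trans x y z x≤y y<z , z<x+1)
             , (y<z , <-≤-trans z (x +ℚ 1ℚ) (y +ℚ 1ℚ) z<x+1 (+1-mono-≤ x y x≤y)))

-- Counting with duplicate-free lists; minimal elements.

lookup-distinct : ∀ {A : Set} {xs : List A} → Unique xs → ∀ {i j} → i Fin.< j → lookup xs i ≢ lookup xs j
lookup-distinct (x≢ ∷ _) {Fin.zero} {Fin.suc j} _ = All.lookup x≢ (∈-lookup j)
lookup-distinct (_ ∷ uniq) {Fin.suc i} {Fin.suc j} (ℕ.s≤s i<j) = lookup-distinct uniq i<j

unique-length : ∀ {A : Set} {m} {f : A → Fin m} → Injective _≡_ _≡_ f →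
  ∀ {xs} → Unique xs → length xs ℕ.≤ m
unique-length {m = m} {f} f-injective {xs} uniq = ℕₚ.≮⇒≥ λ m<∣xs∣ →
  let i , j , i<j , same = Finₚ.pigeonhole m<∣xs∣ (f ∘ lookup xs) in
  lookup-distinct uniq i<j (f-injective same)

-- Distinct representatives: members related by `Q` cannot share an image. `Q` is inequality for
-- edges and the chain order for events.
choose : ∀ {A B : Set} {Q : Rel A 0ℓ} {R : A → B → Set} →
  (∀ {x x′ y} → Q x x′ → R x y → R x′ y → ⊥) →
  ∀ {xs} → AllPairs Q xs → All (λ x → ∃ (R x)) xs →
  ∃ λ ys → length ys ≡ length xs × Unique ys × All (λ y → ∃ λ x → x ∈ xs × R x y) ys
choose disj [] [] = [] , refl , [] , []
choose disj (Qx ∷ Qxs) ((y , Rxy) ∷ Rxs) =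
  let ys , len , uniq , image = choose disj Qxs Rxs in
  y ∷ ys , cong suc len
  , All.map (λ { (x′ , x′∈xs , Rx′y′) refl → disj (All.lookup Qx x′∈xs) Rxy Rx′y′ }) image ∷ uniq
  , (_ , here refl , Rxy) ∷ All.map (λ (x′ , x′∈xs , r) → x′ , there x′∈xs , r) image

split : ∀ {A : Set} {P Q : A → Set₁} {xs} → Unique xs → All (λ x → P x ⊎ Q x) xs →
  ∃ λ ys → ∃ λ zs → length ys ℕ.+ length zs ≡ length xs ×
    (Unique ys × All (_∈ xs) ys × All P ys) × (Unique zs × All (_∈ xs) zs × All Q zs)
split [] [] = [] , [] , refl , ([] , [] , []) , ([] , [] , [])
split (x≢ ∷ uniq) (PQx ∷ PQxs) with split uniq PQxs | PQx
... | ys , zs , len , (uys , ys⊆ , Pys) , (uzs , zs⊆ , Qzs) | inj₁ Px =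
  _ ∷ ys , zs , cong suc len
  , (All.map (All.lookup x≢) ys⊆ ∷ uys , here refl ∷ All.map there ys⊆ , Px ∷ Pys)
  , (uzs , All.map there zs⊆ , Qzs)
... | ys , zs , len , (uys , ys⊆ , Pys) , (uzs , zs⊆ , Qzs) | inj₂ Qx =
  ys , _ ∷ zs , trans (ℕₚ.+-suc _ _) (cong suc len)
  , (uys , All.map there ys⊆ , Pys)
  , (All.map (All.lookup x≢) zs⊆ ∷ uzs , here refl ∷ All.map there zs⊆ , Qx ∷ Qzs)

minimal : ∀ {n} {_⊏_ : Rel (Fin n) 0ℓ} → Transitive _⊏_ → (∀ {x} → ¬ (x ⊏ x)) → Decidable _⊏_ →
  ∀ {P : Fin n → Set} → Unary.Decidable P → ∃ P →
  ∃ λ m → P m × (∀ y → P y → ¬ (y ⊏ m))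
minimal {_⊏_ = _⊏_} ⊏-trans ⊏-irrefl _⊏?_ {P} P? (x , Px) = descend x (Fin.spo-wellFounded isSPO x) Px
  where
  isSPO : IsStrictPartialOrder _≡_ _⊏_
  isSPO = record
    { isEquivalence = isEquivalence
    ; irrefl = λ { refl → ⊏-irrefl }
    ; trans = ⊏-trans
    ; <-resp-≈ = resp₂ _⊏_
    }
  descend : ∀ x → Acc _⊏_ x → P x → ∃ λ m → P m × (∀ y → P y → ¬ (y ⊏ m))
  descend x (acc below) Px with Finₚ.any? (λ y → P? y ×-dec (y ⊏? x))
  ... | yes (y , Py , y⊏x) = descend y (below y⊏x) Py
  ... | no none = x , Px , λ y Py y⊏x → none (y , Py , y⊏x)

-- Semiorders and their chains.

record Semiorder (n : ℕ) : Set₁ where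
  infix 4 _≺_ _⊲_
  field
    _≺_ _⊲_            : Rel (Fin n) 0ℓ
    isStrictTotalOrder : IsStrictTotalOrder _≡_ _≺_
    _⊲?_               : Decidable _⊲_
    ⊲⇒≺                : ∀ {u v} → u ⊲ v → u ≺ v
    -- This encodes the equal length of the intervals: they end in the order in which they start.
    ≺-⊲-trans          : ∀ {u v w} → u ≺ v → v ⊲ w → u ⊲ w
    ⊲-≺-trans          : ∀ {u v w} → u ⊲ v → v ≺ w → u ⊲ w

  open IsStrictTotalOrder isStrictTotalOrder public
    using (compare) renaming (trans to ≺-trans; _<?_ to _≺?_)

  ≺-irrefl : ∀ {v} → ¬ (v ≺ v)
  ≺-irrefl = IsStrictTotalOrder.irrefl isStrictTotalOrder refl

  ⊲-irrefl : ∀ {v} → ¬ (v ⊲ v)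
  ⊲-irrefl v⊲v = ≺-irrefl (⊲⇒≺ v⊲v)

  ⊲-trans : Transitive _⊲_
  ⊲-trans u⊲v v⊲w = ⊲-≺-trans u⊲v (⊲⇒≺ v⊲w)

reverse : ∀ {n} → Semiorder n → Semiorder n
reverse T = record
  { _≺_ = flip _≺_
  ; _⊲_ = flip _⊲_
  ; isStrictTotalOrder = Flip.isStrictTotalOrder isStrictTotalOrder
  ; _⊲?_ = flip _⊲?_
  ; ⊲⇒≺ = ⊲⇒≺
  ; ≺-⊲-trans = flip ⊲-≺-trans
  ; ⊲-≺-trans = flip ≺-⊲-trans
  }
  where open Semiorder T

module _ {n} (T : Semiorder n) where
  open Semiorder T

  Chain : List (Fin n) → Set
  Chain = AllPairs (flip _⊲_)

  -- Recursion on the number `k` of predecessors, instead of a quantifier over lists, keeps this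
  -- decidable by search in `Fin n`.
  EndsChain : ℕ → Fin n → Set
  EndsChain zero w = ⊤
  EndsChain (suc k) w = ∃ λ v → v ⊲ w × EndsChain k v

  endsChain? : ∀ k → Unary.Decidable (EndsChain k)
  endsChain? zero w = yes tt
  endsChain? (suc k) w = Finₚ.any? (λ v → (v ⊲? w) ×-dec endsChain? k v)

  chainTo : ∀ k w → EndsChain k w → ∃ λ vs → length vs ≡ k × Chain (w ∷ vs)
  chainTo zero w _ = [] , refl , [] ∷ []
  chainTo (suc k) w (v , v⊲w , c) with chainTo k v c
  ... | vs , len , ⊲v ∷ chain =
    v ∷ vs , cong suc len , (v⊲w ∷ All.map (λ u⊲v → ⊲-trans u⊲v v⊲w) ⊲v) ∷ ⊲v ∷ chain

  endsChain-bound : ∀ k w → EndsChain k w → k ℕ.< n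
  endsChain-bound k w c with chainTo k w c
  ... | vs , refl , chain =
    unique-length id (AllPairs.map (λ { v⊲u refl → ⊲-irrefl v⊲u }) chain)

  rank : ∀ w → ∃ λ k → EndsChain k w × (∀ j → EndsChain j w → j ℕ.≤ k)
  rank w with search n
    where
    search : ∀ m → ∃ λ k → EndsChain k w × (∀ j → j ℕ.≤ m → EndsChain j w → j ℕ.≤ k)
    search zero = 0 , tt , λ j j≤0 _ → j≤0
    search (suc m) with endsChain? (suc m) w
    ... | yes c = suc m , c , λ j j≤1+m _ → j≤1+m
    ... | no ¬c =
      let k , c , max = search m in
      k , c , λ j j≤1+m d → max j (ℕ.s≤s⁻¹ (ℕₚ.≤∧≢⇒< j≤1+m λ { refl → ¬c d })) d
  ... | k , c , max = k , c , λ j d → max j (ℕₚ.<⇒≤ (endsChain-bound j w d)) d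

  -- Mirsky's theorem for ⊲, in the form of a height function.
  longest-chain : Fin n → ∃ λ vs → Chain vs ×
    ∃ λ (h : Fin n → ℕ) → (∀ v → h v ℕ.< length vs) × (∀ {v w} → v ⊲ w → h v ℕ.< h w)
  -- `minimal` for the reversed comparison of ranks yields an element of largest rank.
  longest-chain v₀ with minimal {_⊏_ = λ v w → h w ℕ.< h v} (flip ℕₚ.<-trans) (ℕₚ.<-irrefl refl)
                          (λ v w → h w ℕ.<? h v) {P = λ _ → ⊤} (λ _ → yes tt) (v₀ , tt)
    where
    h : Fin n → ℕ
    h = proj₁ ∘ rank
  ... | w , _ , max with chainTo _ w (proj₁ (proj₂ (rank w)))
  ... | vs , len , chain = w ∷ vs , chain , proj₁ ∘ rank
    , (λ v → subst (λ k → proj₁ (rank v) ℕ.< suc k) (sym len) (ℕ.s≤s (ℕₚ.≮⇒≥ (max v tt))))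
    , λ {u} {v} u⊲v → proj₂ (proj₂ (rank v)) _ (u , u⊲v , proj₁ (proj₂ (rank u)))

-- Sweeping along one semiorder across the other.

Comparable : ∀ {n} → Semiorder n → Semiorder n → Set
Comparable T S = ∀ v w → v ≢ w →
  (v T.⊲ w ⊎ w T.⊲ v) ⊎ (v S.⊲ w ⊎ w S.⊲ v)
  where
  module T = Semiorder T
  module S = Semiorder S

-- Read T as time and S as the position across it: v is alive from its birth to
-- its death, v ⊲ w in T says that v dies before w is born, and v ⊲ w in S that v
-- lies to the left of w.  Reversing T exchanges births and deaths, so
-- LeftmostAtBirth (reverse T) S means leftmost at death; reversing S exchanges
-- left and right.
module _ {n} (T S : Semiorder n) where
  open Semiorder T
  open Semiorder S using () renaming (_⊲_ to _◁_)

  LeftmostAtBirth : Fin n → Set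
  LeftmostAtBirth v = ∀ u → u ≺ v → ¬ (u ⊲ v) → ¬ (u ◁ v)

  LeftNeighbourAtBirth : Fin n → Fin n → Set
  LeftNeighbourAtBirth u v = u ≺ v × ¬ (u ⊲ v) × u ◁ v ×
    (∀ z → z ≺ v → ¬ (z ⊲ v) → u ◁ z → ¬ (z ◁ v))

  -- A line on which v sees w lies after their births and before their deaths, so
  -- among the squares between v and w, those born before one of the two have
  -- died below it, and those dying after one of the two are born above it.
  Sees : Fin n → Fin n → Set
  Sees v w = v ◁ w × ¬ (v ⊲ w) × ¬ (w ⊲ v) ×
    (∀ u z → v ◁ u → u ◁ w → v ◁ z → z ◁ w → u ≺ v ⊎ u ≺ w → v ≺ z ⊎ w ≺ z → u ⊲ z)

  SeesEitherWay : Fin n × Fin n → Set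
  SeesEitherWay (v , w) = Sees v w ⊎ Sees w v

-- Charging adjacencies to births and deaths.

pattern birthˡ v = 0F , v
pattern birthʳ v = 1F , v
pattern death v = 2F , v

Slot : ℕ → Set
Slot n = Fin 3 × Fin n

-- The owner is the adjacency that the event creates: a newborn `q` with its neighbour on one side,
-- or the two neighbours of a dying `u` with each other.
Owns : ∀ {n} → Semiorder n → Semiorder n → Slot n → Fin n → Fin n → Set
Owns T S (birthˡ q) v w = w ≡ q × LeftNeighbourAtBirth T S v q
Owns T S (birthʳ q) v w = v ≡ q × LeftNeighbourAtBirth T (reverse S) w q
Owns T S (death u) v w =
  LeftNeighbourAtBirth (reverse T) S v u × LeftNeighbourAtBirth (reverse T) (reverse S) w u

comparable-reverseˡ : ∀ {n} (T S : Semiorder n) → Comparable T S → Comparable (reverse T) S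
comparable-reverseˡ T S cmp v w v≢w = Sum.map₁ Sum.swap (cmp v w v≢w)

comparable-reverseʳ : ∀ {n} (T S : Semiorder n) → Comparable T S → Comparable T (reverse S)
comparable-reverseʳ T S cmp v w v≢w = Sum.map₂ Sum.swap (cmp v w v≢w)

module _ {n} (T S : Semiorder n) (cmp : Comparable T S) where
  open Semiorder T
  open Semiorder S using () renaming (_⊲_ to _◁_; _⊲?_ to _◁?_; ⊲-trans to ◁-trans; ⊲-irrefl to ◁-irrefl)

  -- Two squares alive at the birth of `v` are not separated in time, so they lie side by side, and
  -- the nearer one comes between the other and `v`.
  neighbour-unique : ∀ {u u′ v} → LeftNeighbourAtBirth T S u v → LeftNeighbourAtBirth T S u′ v → u ≡ u′
  neighbour-unique {u} {u′} (u≺v , u⋪v , u◁v , near) (u′≺v , u′⋪v , u′◁v , near′) with u Finₚ.≟ u′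
  ... | yes u≡u′ = u≡u′
  ... | no u≢u′ with cmp u u′ u≢u′
  ... | inj₁ (inj₁ u⊲u′) = contradiction (⊲-≺-trans u⊲u′ u′≺v) u⋪v
  ... | inj₁ (inj₂ u′⊲u) = contradiction (⊲-≺-trans u′⊲u u≺v) u′⋪v
  ... | inj₂ (inj₁ u◁u′) = contradiction u′◁v (near u′ u′≺v u′⋪v u◁u′)
  ... | inj₂ (inj₂ u′◁u) = contradiction u◁v (near′ u u≺v u⋪v u′◁u)

  -- Let ℓ be the leftmost square alive at the birth of t.  If ℓ is not leftmost
  -- when it dies, then it was overtaken, and the first square born after t to the
  -- left of ℓ was leftmost at its birth.
  leftmost-event : ∀ t →
    (∃ λ v → LeftmostAtBirth T S v × t ≺ v × ¬ (t ⊲ v)) ⊎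
    (∃ λ u → LeftmostAtBirth (reverse T) S u × (u ≡ t ⊎ u ≺ t) × ¬ (u ⊲ t))
  leftmost-event t
    with minimal ◁-trans ◁-irrefl _◁?_
           {P = λ u → (u ≡ t ⊎ u ≺ t) × ¬ (u ⊲ t)}
           (λ u → ((u Finₚ.≟ t) ⊎-dec (u ≺? t)) ×-dec ¬? (u ⊲? t)) (t , inj₁ refl , ⊲-irrefl)
  ... | ℓ , (ℓ≼t , ℓ⋪t) , leftmost
    with Finₚ.any? (λ z → (t ≺? z) ×-dec (¬? (t ⊲? z) ×-dec (z ◁? ℓ)))
  ... | no not-overtaken = inj₂ (ℓ , leftmost-at-death , ℓ≼t , ℓ⋪t)
    where
    leftmost-at-death : LeftmostAtBirth (reverse T) S ℓ
    leftmost-at-death u ℓ≺u ℓ⋪u u◁ℓ with compare u t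
    ... | tri< u≺t _ _ = leftmost u (inj₂ u≺t , ℓ⋪t ∘ ≺-⊲-trans ℓ≺u) u◁ℓ
    ... | tri≈ _ u≡t _ = leftmost u (inj₁ u≡t , λ u⊲t → ℓ⋪t (≺-⊲-trans ℓ≺u u⊲t)) u◁ℓ
    ... | tri> _ _ t≺u = not-overtaken (u , t≺u , t⋪u ℓ≼t , u◁ℓ)
      where
      -- `t` dies no earlier than `ℓ`, which is still alive when `u` is born.
      t⋪u : ℓ ≡ t ⊎ ℓ ≺ t → ¬ (t ⊲ u)
      t⋪u (inj₁ refl) = ℓ⋪u
      t⋪u (inj₂ ℓ≺t) = ℓ⋪u ∘ ≺-⊲-trans ℓ≺t
  ... | yes overtaken
    with minimal ≺-trans ≺-irrefl _≺?_ (λ z → (t ≺? z) ×-dec (¬? (t ⊲? z) ×-dec (z ◁? ℓ))) overtaken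
  ... | m , (t≺m , t⋪m , m◁ℓ) , first = inj₁ (m , leftmost-at-birth , t≺m , t⋪m)
    where
    leftmost-at-birth : LeftmostAtBirth T S m
    leftmost-at-birth u u≺m u⋪m u◁m with compare u t
    ... | tri< u≺t _ _ = leftmost u (inj₂ u≺t , λ u⊲t → u⋪m (⊲-≺-trans u⊲t t≺m)) (◁-trans u◁m m◁ℓ)
    ... | tri≈ _ refl _ = leftmost u (inj₁ refl , ⊲-irrefl) (◁-trans u◁m m◁ℓ)
    ... | tri> _ _ t≺u =
      first u (t≺u , (λ t⊲u → t⋪m (⊲-≺-trans t⊲u u≺m)) , ◁-trans u◁m m◁ℓ) u≺m

  -- If squares alive at the birth of `w` lie between `v` and `w`, the last born of them also dies
  -- last, and its death makes `v` and `w` adjacent.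
  later-owner : ∀ {v w} → Sees T S v w → v ≺ w →
    LeftNeighbourAtBirth T S v w ⊎
    (∃ λ u → LeftNeighbourAtBirth (reverse T) S v u × LeftNeighbourAtBirth (reverse T) (reverse S) w u)
  later-owner {v} {w} (v◁w , v⋪w , _ , clear) v≺w
    with Finₚ.any? (λ z → (z ≺? w) ×-dec (¬? (z ⊲? w) ×-dec ((v ◁? z) ×-dec (z ◁? w))))
  ... | no none = inj₁ (v≺w , v⋪w , v◁w , λ z z≺w z⋪w v◁z z◁w → none (z , z≺w , z⋪w , v◁z , z◁w))
  ... | yes some
    with minimal (flip ≺-trans) ≺-irrefl (flip _≺?_)
           (λ z → (z ≺? w) ×-dec (¬? (z ⊲? w) ×-dec ((v ◁? z) ×-dec (z ◁? w)))) some
  ... | u , (u≺w , u⋪w , v◁u , u◁w) , last = inj₂ (u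
    , (u≺v , (λ u⊲v → u⋪w (⊲-≺-trans u⊲v v≺w)) , v◁u
      , λ z u≺z u⋪z v◁z z◁u → nothing-between z u≺z u⋪z v◁z (◁-trans z◁u u◁w))
    , (u≺w , u⋪w , u◁w
      , λ z u≺z u⋪z z◁w u◁z → nothing-between z u≺z u⋪z (◁-trans v◁u u◁z) z◁w))
    where
    u≺v : u ≺ v
    u≺v with compare u v
    ... | tri< u≺v _ _ = u≺v
    ... | tri≈ _ refl _ = contradiction v◁u ◁-irrefl
    -- Born between the births of `v` and `w`, `u` could play both roles in `clear` and would die
    -- before its own birth.
    ... | tri> _ _ v≺u =
      contradiction (clear u u v◁u u◁w v◁u u◁w (inj₂ u≺w) (inj₁ v≺u)) ⊲-irrefl
    nothing-between : ∀ z → u ≺ z → ¬ (u ⊲ z) → v ◁ z → z ◁ w → ⊥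
    nothing-between z u≺z u⋪z v◁z z◁w with compare z w
    ... | tri< z≺w _ _ = last z (z≺w , (λ z⊲w → u⋪w (≺-⊲-trans u≺z z⊲w)) , v◁z , z◁w) u≺z
    ... | tri≈ _ refl _ = ◁-irrefl z◁w
    ... | tri> _ _ w≺z = u⋪z (clear u z v◁u u◁w v◁z z◁w (inj₂ u≺w) (inj₂ w≺z))

-- Slots lost at the two ends.

LeftEvent : ∀ {n} → Semiorder n → Semiorder n → Fin n → Slot n → Set
LeftEvent T S t (birthˡ v) = LeftmostAtBirth T S v × t ≺ v × ¬ (t ⊲ v)
  where open Semiorder T
LeftEvent T S t (birthʳ v) = ⊥
LeftEvent T S t (death u) = LeftmostAtBirth (reverse T) S u × (u ≡ t ⊎ u ≺ t) × ¬ (u ⊲ t)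
  where open Semiorder T

-- Left events exclude the birth of `t` and include its death; right events do the opposite. This
-- keeps the left birth slot of the first square free, and a square that dies alone from being lost
-- on both sides.
RightEvent : ∀ {n} → Semiorder n → Semiorder n → Fin n → Slot n → Set
RightEvent T S t (birthˡ v) = ⊥
RightEvent T S t (birthʳ v) = LeftmostAtBirth T (reverse S) v × (v ≡ t ⊎ t ≺ v) × ¬ (t ⊲ v)
  where open Semiorder T
RightEvent T S t (death u) = LeftmostAtBirth (reverse T) (reverse S) u × u ≺ t × ¬ (u ⊲ t)
  where open Semiorder T

module _ {n} (T S : Semiorder n) (cmp : Comparable T S) where
  open Semiorder T
  open Semiorder S using () renaming (_⊲_ to _◁_; ⊲-irrefl to ◁-irrefl)

  private
    cmpˡ = comparable-reverseˡ T S cmp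
    cmpʳ = comparable-reverseʳ T S cmp
    cmpˡʳ = comparable-reverseʳ (reverse T) S cmpˡ

  sees⇒owns : ∀ {v w} → Sees T S v w → ∃ λ s → Owns T S s v w
  sees⇒owns {v} {w} sees@(v◁w , v⋪w , w⋪v , clear) with compare v w
  ... | tri< v≺w _ _ with later-owner T S cmp sees v≺w
  ... | inj₁ at-birth = birthˡ w , refl , at-birth
  ... | inj₂ (u , at-death) = death u , at-death
  sees⇒owns {v} {w} (v◁w , _) | tri≈ _ refl _ = contradiction v◁w ◁-irrefl
  sees⇒owns {v} {w} (v◁w , v⋪w , w⋪v , clear) | tri> _ _ w≺v
    -- Now the left square is born later; the reflection puts it on the right.
    with later-owner T (reverse S) cmpʳ {w} {v}
           (v◁w , w⋪v , v⋪w , λ u z u◁w v◁u z◁w v◁z u≺ ≺z →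
             clear u z v◁u u◁w v◁z z◁w (Sum.swap u≺) (Sum.swap ≺z)) w≺v
  ... | inj₁ at-birth = birthʳ v , refl , at-birth
  ... | inj₂ (u , w-right , v-left) = death u , v-left , w-right

  owns-unique : ∀ s {v w v′ w′} → Owns T S s v w → Owns T S s v′ w′ → v ≡ v′ × w ≡ w′
  owns-unique (birthˡ q) (refl , l) (refl , l′) = neighbour-unique T S cmp l l′ , refl
  owns-unique (birthʳ q) (refl , r) (refl , r′) = refl , neighbour-unique T (reverse S) cmpʳ r r′
  owns-unique (death u) (l , r) (l′ , r′) =
    neighbour-unique (reverse T) S cmpˡ l l′ , neighbour-unique (reverse T) (reverse S) cmpˡʳ r r′

  -- The owner supplies a neighbour on the side where the event has none.
  owned-not-left : ∀ s {v w t} → Owns T S s v w → ¬ LeftEvent T S t s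
  owned-not-left (birthˡ q) (_ , u≺q , u⋪q , u◁q , _) (leftmost , _) = leftmost _ u≺q u⋪q u◁q
  owned-not-left (death u) ((u≺v , u⋪v , v◁u , _) , _) (leftmost , _) = leftmost _ u≺v u⋪v v◁u

  owned-not-right : ∀ s {v w t} → Owns T S s v w → ¬ RightEvent T S t s
  owned-not-right (birthʳ q) (_ , u≺q , u⋪q , q◁u , _) (rightmost , _) = rightmost _ u≺q u⋪q q◁u
  owned-not-right (death u) (_ , u≺w , u⋪w , u◁w , _) (rightmost , _) = rightmost _ u≺w u⋪w u◁w

  -- Only a death can be both, and `t′` outlives `u`: being alive at the death of `u`, it lies on
  -- one side of `u`.
  left-not-right : ∀ s {t t′} → LeftEvent T S t s → ¬ RightEvent T S t′ s
  left-not-right (death u) {t′ = t′} (leftmost , _) (rightmost , u≺t′ , u⋪t′)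
    with cmp u t′ (λ { refl → ≺-irrefl u≺t′ })
  ... | inj₁ (inj₁ u⊲t′) = u⋪t′ u⊲t′
  ... | inj₁ (inj₂ t′⊲u) = ≺-irrefl (≺-trans u≺t′ (⊲⇒≺ t′⊲u))
  ... | inj₂ (inj₁ u◁t′) = rightmost t′ u≺t′ u⋪t′ u◁t′
  ... | inj₂ (inj₂ t′◁u) = leftmost t′ u≺t′ u⋪t′ t′◁u

  left-disjoint : ∀ {t t′} s → t′ ⊲ t → LeftEvent T S t s → ¬ LeftEvent T S t′ s
  left-disjoint (birthˡ v) t′⊲t (_ , t≺v , _) (_ , _ , t′⋪v) = t′⋪v (⊲-≺-trans t′⊲t t≺v)
  left-disjoint (death u) t′⊲t (_ , _ , u⋪t) (_ , inj₁ refl , _) = u⋪t t′⊲t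
  left-disjoint (death u) t′⊲t (_ , _ , u⋪t) (_ , inj₂ u≺t′ , _) = u⋪t (≺-⊲-trans u≺t′ t′⊲t)

  right-disjoint : ∀ {t t′} s → t′ ⊲ t → RightEvent T S t s → ¬ RightEvent T S t′ s
  right-disjoint (birthʳ v) t′⊲t (_ , inj₁ refl , _) (_ , _ , t′⋪v) = t′⋪v t′⊲t
  right-disjoint (birthʳ v) t′⊲t (_ , inj₂ t≺v , _) (_ , _ , t′⋪v) = t′⋪v (⊲-≺-trans t′⊲t t≺v)
  right-disjoint (death u) t′⊲t (_ , _ , u⋪t) (_ , u≺t′ , _) = u⋪t (≺-⊲-trans u≺t′ t′⊲t)

  left-event : ∀ t → ∃ (LeftEvent T S t)
  left-event t with leftmost-event T S cmp t
  ... | inj₁ (v , event) = birthˡ v , event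
  ... | inj₂ (u , event) = death u , event

  -- A half turn exchanges births with deaths and left with right.
  right-event : ∀ t → ∃ (RightEvent T S t)
  right-event t with leftmost-event (reverse T) (reverse S) cmpˡʳ t
  ... | inj₁ (u , event) = death u , event
  ... | inj₂ (v , event) = birthʳ v , event

  -- Edges are listed in index order, whereas owners are ordered by position.
  OwnsEdge : Fin n × Fin n → Slot n → Set
  OwnsEdge (v , w) s = v Fin.< w × (Owns T S s v w ⊎ Owns T S s w v)

  edge-unique : ∀ {e e′} s → OwnsEdge e s → OwnsEdge e′ s → e ≡ e′
  edge-unique s (_ , inj₁ o) (_ , inj₁ o′) with owns-unique s o o′
  ... | refl , refl = refl
  edge-unique s (v<w , inj₁ o) (w<v , inj₂ o′) with owns-unique s o o′
  ... | refl , refl = contradiction w<v (ℕₚ.<-asym v<w)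
  edge-unique s (v<w , inj₂ o) (w<v , inj₁ o′) with owns-unique s o o′
  ... | refl , refl = contradiction w<v (ℕₚ.<-asym v<w)
  edge-unique s (_ , inj₂ o) (_ , inj₂ o′) with owns-unique s o o′
  ... | refl , refl = refl

  -- Distinct slots are collected: one per edge, one at each end per chain member, and the left
  -- birth slot of the first square.
  sees-bound : ∀ {es} → Unique es → All (λ (v , w) → v Fin.< w × SeesEitherWay T S (v , w)) es →
    ∀ {ts} → Chain T ts → Fin n → length es ℕ.+ (suc (length ts) ℕ.+ length ts) ℕ.≤ 3 ℕ.* n
  sees-bound {es} unique-es sees {ts} chain v₀
    with choose {R = OwnsEdge} (λ e≢e′ o o′ → e≢e′ (edge-unique _ o o′)) unique-es
           (All.map (λ { (v<w , inj₁ see) → let s , o = sees⇒owns see in s , v<w , inj₁ o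
                       ; (v<w , inj₂ see) → let s , o = sees⇒owns see in s , v<w , inj₂ o }) sees)
       | choose (left-disjoint _) chain (All.universal left-event ts)
       | choose (right-disjoint _) chain (All.universal right-event ts)
       | minimal ≺-trans ≺-irrefl _≺?_ {P = λ _ → ⊤} (λ _ → yes tt) (v₀ , tt)
  ... | owned , ∣owned∣ , unique-owned , owned-slots
      | left , ∣left∣ , unique-left , left-slots
      | right , ∣right∣ , unique-right , right-slots
      | first , _ , none-before =
    subst (ℕ._≤ 3 ℕ.* n) total
      (unique-length {f = λ (i , v) → Fin.combine i v}
        (λ {s} {s′} eq → let i≡ , v≡ = Finₚ.combine-injective (proj₁ s) (proj₂ s) (proj₁ s′) (proj₂ s′) eq
                         in cong₂ _,_ i≡ v≡)
        unique-slots)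
    where
    total : length (owned ++ (birthˡ first ∷ left) ++ right) ≡ length es ℕ.+ (suc (length ts) ℕ.+ length ts)
    total = trans (Listₚ.length-++ owned) (cong₂ ℕ._+_ ∣owned∣
      (cong suc (trans (Listₚ.length-++ left) (cong₂ ℕ._+_ ∣left∣ ∣right∣))))
    unique-slots : Unique (owned ++ (birthˡ first ∷ left) ++ right)
    unique-slots = Uniqueₚ.++⁺ unique-owned
      (Uniqueₚ.++⁺
        -- A birth counted as a left event comes strictly after that of some `t`, so it is not the
        -- first one.
        (All.map (λ { (t , _ , event) refl → none-before t tt (proj₁ (proj₂ event)) }) left-slots ∷ unique-left)
        unique-right
        λ { (here refl , ∈right) → proj₂ (proj₂ (All.lookup right-slots ∈right))
          ; (there ∈left , ∈right) → left-not-right _ (proj₂ (proj₂ (All.lookup left-slots ∈left)))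
                                                     (proj₂ (proj₂ (All.lookup right-slots ∈right))) })
      λ (∈owned , ∈lost) → owned-not-lost ∈lost (proj₂ (proj₂ (All.lookup owned-slots ∈owned)))
      where
      unowned : ∀ s {e} → (∀ {v w} → ¬ Owns T S s v w) → ¬ OwnsEdge e s
      unowned s ¬o (_ , o) = [ ¬o , ¬o ]′ o
      owned-not-lost : ∀ {s e} → s ∈ (birthˡ first ∷ left) ++ right → ¬ OwnsEdge e s
      owned-not-lost (here refl) = unowned (birthˡ first) λ (_ , u≺first , _) → none-before _ tt u≺first
      owned-not-lost {s} (there ∈lost) with ∈-++⁻ left ∈lost
      ... | inj₁ ∈left = unowned s λ o → owned-not-left s o (proj₂ (proj₂ (All.lookup left-slots ∈left)))
      ... | inj₂ ∈right = unowned s λ o → owned-not-right s o (proj₂ (proj₂ (All.lookup right-slots ∈right)))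

-- Unit squares as a pair of semiorders.

Decides : ∀ {n} → (Fin n → ℝ) → Set
Decides c = ∀ v w → Dec (c v ≤ c w) × Dec (c v +ℚ 1ℚ ≤ c w)

¬¬-decides : ∀ {n} (c : Fin n → ℝ) → ¬ ¬ Decides c
¬¬-decides c = ¬¬-sequence λ v → ¬¬-sequence λ w ¬both →
  ¬¬-excluded-middle λ ≤? → ¬¬-excluded-middle λ +1≤? → ¬both (≤? , +1≤?)
  where
  ¬¬-sequence : ∀ {m} {P : Fin m → Set} → (∀ i → ¬ ¬ P i) → ¬ ¬ (∀ i → P i)
  ¬¬-sequence = Finₚ.sequence (RawMonad.rawApplicative ¬¬-Monad)

module _ {n} (c : Fin n → ℝ) (decides : Decides c) where

  -- Equal coordinates are ordered by index.  The ties are broken in the same way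
  -- at both ends of the unit intervals, which keeps births and deaths in the
  -- same order.
  semiorder : Semiorder n
  semiorder = record
    { _≺_ = _≺_
    ; _⊲_ = _⊲_
    ; isStrictTotalOrder = isStrictTotalOrderᶜ record
      { isEquivalence = isEquivalence
      ; trans = λ {u} {v} {w} → ≺-trans u v w
      ; compare = compare
      }
    ; _⊲?_ = λ v w → proj₂ (decides v w)
    ; ⊲⇒≺ = λ {u} {v} → ⊲⇒≺ u v
    ; ≺-⊲-trans = λ {u} {v} {w} (u≤v , _) v⊲w →
        ≤-trans (c u +ℚ 1ℚ) (c v +ℚ 1ℚ) (c w) (+1-mono-≤ (c u) (c v) u≤v) v⊲w
    ; ⊲-≺-trans = λ {u} {v} {w} u⊲v (v≤w , _) → ≤-trans (c u +ℚ 1ℚ) (c v) (c w) u⊲v v≤w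
    }
    where
    _≺_ _⊲_ : Fin n → Fin n → Set
    v ≺ w = c v ≤ c w × (c w ≤ c v → v Fin.< w)
    v ⊲ w = c v +ℚ 1ℚ ≤ c w

    ≺-trans : ∀ u v w → u ≺ v → v ≺ w → u ≺ w
    ≺-trans u v w (u≤v , u<v) (v≤w , v<w) = ≤-trans (c u) (c v) (c w) u≤v v≤w , λ w≤u →
      ℕₚ.<-trans (u<v (≤-trans (c v) (c w) (c u) v≤w w≤u)) (v<w (≤-trans (c w) (c u) (c v) w≤u u≤v))

    compare : Trichotomous _≡_ _≺_
    compare v w with proj₁ (decides v w) | proj₁ (decides w v)
    ... | no v≰w | no w≰v = ⊥-elim (v≰w λ w<v → w≰v (<⇒≤ (c w) (c v) w<v))
    ... | yes v≤w | no w≰v =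
      tri< (v≤w , λ w≤v → contradiction w≤v w≰v) (λ { refl → w≰v v≤w }) (w≰v ∘ proj₁)
    ... | no v≰w | yes w≤v =
      tri> (v≰w ∘ proj₁) (λ { refl → v≰w w≤v }) (w≤v , λ v≤w → contradiction v≤w v≰w)
    ... | yes v≤w | yes w≤v with Finₚ.<-cmp v w
    ... | tri< v<w v≢w w≮v = tri< (v≤w , λ _ → v<w) v≢w λ (_ , w<v) → w≮v (w<v v≤w)
    ... | tri≈ v≮w v≡w w≮v = tri≈ (λ (_ , v<w) → v≮w (v<w w≤v)) v≡w λ (_ , w<v) → w≮v (w<v v≤w)
    ... | tri> v≮w v≢w w<v = tri> (λ (_ , v<w) → v≮w (v<w w≤v)) v≢w (w≤v , λ _ → w<v)

    ⊲⇒≺ : ∀ u v → u ⊲ v → u ≺ v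
    ⊲⇒≺ u v u⊲v =
      (λ v<u → x+1≰x (c u) (≤-trans (c u +ℚ 1ℚ) (c v) (c u) u⊲v (<⇒≤ (c v) (c u) v<u))) ,
      λ v≤u → ⊥-elim (x+1≰x (c u) (≤-trans (c u +ℚ 1ℚ) (c v) (c u) u⊲v v≤u))

module _ {n} (S : Fin n → Square) (disjoint : DisjointInteriors S)
  (decidesˣ : Decides (proj₁ ∘ S)) (decidesʸ : Decides (proj₂ ∘ S)) where

  private
    x y : Fin n → ℝ
    x = proj₁ ∘ S
    y = proj₂ ∘ S
    X Y : Semiorder n
    X = semiorder x decidesˣ
    Y = semiorder y decidesʸ
    open Semiorder Y using (_≺_; _⊲_)
    open Semiorder X using () renaming (_⊲_ to _◁_; ⊲-irrefl to ◁-irrefl)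

  -- Squares whose projections overlap on both axes would share an interior point.
  comparable : Comparable Y X
  comparable v w v≢w
    with proj₂ (decidesʸ v w) | proj₂ (decidesʸ w v) | proj₂ (decidesˣ v w) | proj₂ (decidesˣ w v)
  ... | yes v⊲w | _ | _ | _ = inj₁ (inj₁ v⊲w)
  ... | no _ | yes w⊲v | _ | _ = inj₁ (inj₂ w⊲v)
  ... | no _ | no _ | yes v◁w | _ = inj₂ (inj₁ v◁w)
  ... | no _ | no _ | no _ | yes w◁v = inj₂ (inj₂ w◁v)
  ... | no v⋪w | no w⋪v | no ¬v◁w | no ¬w◁v =
    ⊥-elim (overlapping-unit-intervals (x v) (x w) ¬v◁w ¬w◁v λ (p , p∈v , p∈w) →
      overlapping-unit-intervals (y v) (y w) v⋪w w⋪v λ (q , q∈v , q∈w) →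
      disjoint v≢w (p , q) (p∈v , q∈v) (p∈w , q∈w))

  -- One line of the band suffices. Its height `h` separates `u` from `z`: both miss the line, `u`
  -- starts below it and `z` ends above it.
  clear-line⇒sees : ∀ v w h → v ◁ w → InUnitInterval (y v) h → InUnitInterval (y w) h →
    (∀ u → u ≢ v → u ≢ w → ∀ p → x v +ℚ 1ℚ ≤ p → p ≤ x w → ¬ Interior (S u) (p , h)) →
    Sees Y X v w
  clear-line⇒sees v w h v◁w (v<h , h<v) (w<h , h<w) clear =
    v◁w
    , (λ v⊲w → v⊲w (<-trans (y w) h (y v +ℚ 1ℚ) w<h h<v))
    , (λ w⊲v → w⊲v (<-trans (y v) h (y w +ℚ 1ℚ) v<h h<w))
    , λ u z v◁u u◁w v◁z z◁w u≺ ≺z → ≤-trans (y u +ℚ 1ℚ) h (y z)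
        (λ h<u → missed u v◁u u◁w (born u u≺ , h<u))
        (λ z<h → missed z v◁z z◁w (z<h , not-dead z ≺z))
    where
    missed : ∀ u → v ◁ u → u ◁ w → ¬ InUnitInterval (y u) h
    -- As the goal is absurdity, `x u < x u +ℚ 1ℚ` may be assumed; it gives an abscissa inside `u`.
    missed u v◁u u◁w h∈u = x+1≰x (x u) λ u<u+1 →
      let p , u<p , p<u+1 = <-dense (x u) (x u +ℚ 1ℚ) u<u+1 in
      clear u (λ { refl → ◁-irrefl v◁u }) (λ { refl → ◁-irrefl u◁w }) p
        (≤-trans (x v +ℚ 1ℚ) (x u) p v◁u (<⇒≤ (x u) p u<p))
        (≤-trans p (x u +ℚ 1ℚ) (x w) (<⇒≤ p (x u +ℚ 1ℚ) p<u+1) u◁w)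
        ((u<p , p<u+1) , h∈u)
    born : ∀ u → u ≺ v ⊎ u ≺ w → y u < h
    born u (inj₁ (u≤v , _)) = ≤-<-trans (y u) (y v) h u≤v v<h
    born u (inj₂ (u≤w , _)) = ≤-<-trans (y u) (y w) h u≤w w<h
    not-dead : ∀ z → v ≺ z ⊎ w ≺ z → h < y z +ℚ 1ℚ
    not-dead z (inj₁ (v≤z , _)) = <-≤-trans h (y v +ℚ 1ℚ) (y z +ℚ 1ℚ) h<v (+1-mono-≤ (y v) (y z) v≤z)
    not-dead z (inj₂ (w≤z , _)) = <-≤-trans h (y w +ℚ 1ℚ) (y z +ℚ 1ℚ) h<w (+1-mono-≤ (y w) (y z) w≤z)

  band⇒sees : ∀ v w → v ≢ w → HorizontalBand S v w → SeesEitherWay Y X (v , w)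
  band⇒sees v w v≢w (lo , hi , lo<hi , band)
    with h , lo<h , h<hi ← <-dense lo hi lo<hi
    with (_ , _ , h∈v) , (_ , _ , h∈w) , clear ← band h lo<h h<hi
    with comparable v w v≢w
  ... | inj₁ (inj₁ v⊲w) = ⊥-elim (v⊲w (<-trans (y w) h (y v +ℚ 1ℚ) (proj₁ h∈w) (proj₂ h∈v)))
  ... | inj₁ (inj₂ w⊲v) = ⊥-elim (w⊲v (<-trans (y v) h (y w +ℚ 1ℚ) (proj₁ h∈v) (proj₂ h∈w)))
  ... | inj₂ (inj₁ v◁w) = inj₁ (clear-line⇒sees v w h v◁w h∈v h∈w
    λ u u≢v u≢w p v≤p p≤w → clear u u≢v u≢w p (inj₁ (v≤p , p≤w)))
  ... | inj₂ (inj₂ w◁v) = inj₂ (clear-line⇒sees w v h w◁v h∈w h∈v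
    λ u u≢w u≢v p w≤p p≤v → clear u u≢v u≢w p (inj₂ (w≤p , p≤v)))

  horizontal-bound : ∀ {es} → Unique es → All (λ (v , w) → v Fin.< w × HorizontalBand S v w) es →
    ∀ {ts} → Chain Y ts → Fin n → length es ℕ.+ (suc (length ts) ℕ.+ length ts) ℕ.≤ 3 ℕ.* n
  horizontal-bound unique-es bands = sees-bound Y X comparable unique-es
    (All.map (λ (v<w , band) → v<w , band⇒sees _ _ (Finₚ.<⇒≢ v<w) band) bands)

-- From chain lengths to the numerical bound.

comparable⇒product-bound : ∀ {n a b} (T S : Semiorder n) → Comparable T S →
  (h k : Fin n → ℕ) → (∀ v → h v ℕ.< a) → (∀ v → k v ℕ.< b) →
  (∀ {v w} → Semiorder._⊲_ T v w → h v ℕ.< h w) → (∀ {v w} → Semiorder._⊲_ S v w → k v ℕ.< k w) →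
  n ℕ.≤ a ℕ.* b
comparable⇒product-bound {n} {a} {b} T S cmp h k h< k< h-mono k-mono = Finₚ.injective⇒≤ {f = place} injective
  where
  place : Fin n → Fin (a ℕ.* b)
  place v = Fin.combine (Fin.fromℕ< (h< v)) (Fin.fromℕ< (k< v))
  injective : ∀ {v w} → place v ≡ place w → v ≡ w
  injective {v} {w} eq with v Finₚ.≟ w
  ... | yes v≡w = v≡w
  ... | no v≢w
    with Finₚ.combine-injective (Fin.fromℕ< (h< v)) (Fin.fromℕ< (k< v))
           (Fin.fromℕ< (h< w)) (Fin.fromℕ< (k< w)) eq
  ... | same-h , same-k
    with Finₚ.fromℕ<-injective (h v) (h w) (h< v) (h< w) same-h
       | Finₚ.fromℕ<-injective (k v) (k w) (k< v) (k< w) same-k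
  ... | hv≡hw | kv≡kw with cmp v w v≢w
  ... | inj₁ (inj₁ v⊲w) = contradiction (h-mono v⊲w) (ℕₚ.<-irrefl hv≡hw)
  ... | inj₁ (inj₂ w⊲v) = contradiction (h-mono w⊲v) (ℕₚ.<-irrefl (sym hv≡hw))
  ... | inj₂ (inj₁ v◁w) = contradiction (k-mono v◁w) (ℕₚ.<-irrefl kv≡kw)
  ... | inj₂ (inj₂ w◁v) = contradiction (k-mono w◁v) (ℕₚ.<-irrefl (sym kv≡kw))

-- With `m = a + d`, `b` is at most `m + d`, and the product of `m - d` and `m + d` is at most the
-- square of `m`. Otherwise `a` and `b` change roles.
product≤square : ∀ a b m → a ℕ.+ b ℕ.≤ m ℕ.+ m → a ℕ.* b ℕ.≤ m ℕ.* m
product≤square a b m a+b≤2m = [ (λ a≤m → below a b a≤m a+b≤2m) , above ]′ (ℕₚ.≤-total a m)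
  where
  difference-of-squares : ∀ a d → a ℕ.* (d ℕ.+ (a ℕ.+ d)) ℕ.+ d ℕ.* d ≡ (a ℕ.+ d) ℕ.* (a ℕ.+ d)
  difference-of-squares = solve-∀
  below : ∀ a b {m} → a ℕ.≤ m → a ℕ.+ b ℕ.≤ m ℕ.+ m → a ℕ.* b ℕ.≤ m ℕ.* m
  below a b a≤m a+b≤2m with d , refl ← ℕₚ.m≤n⇒∃[o]m+o≡n a≤m = begin
    a ℕ.* b                                ≤⟨ ℕₚ.*-monoʳ-≤ a (ℕₚ.+-cancelˡ-≤ a _ _
                                                (subst (a ℕ.+ b ℕ.≤_) (ℕₚ.+-assoc a d (a ℕ.+ d)) a+b≤2m)) ⟩
    a ℕ.* (d ℕ.+ (a ℕ.+ d))                ≤⟨ ℕₚ.m≤m+n _ (d ℕ.* d) ⟩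
    a ℕ.* (d ℕ.+ (a ℕ.+ d)) ℕ.+ d ℕ.* d    ≡⟨ difference-of-squares a d ⟩
    (a ℕ.+ d) ℕ.* (a ℕ.+ d)                ∎
    where open ℕₚ.≤-Reasoning
  above : m ℕ.≤ a → a ℕ.* b ℕ.≤ m ℕ.* m
  above m≤a = subst (ℕ._≤ m ℕ.* m) (ℕₚ.*-comm b a)
    (below b a (ℕₚ.+-cancelˡ-≤ m _ _ (ℕₚ.≤-trans (ℕₚ.+-monoˡ-≤ b m≤a) a+b≤2m))
      (subst (ℕ._≤ m ℕ.+ m) (ℕₚ.+-comm a b) a+b≤2m))

-- For `k = suc m`, failure means that `a + b` is at most `2m`; then the square of `m` already
-- reaches `n`, against the leastness of `k`.
least-root-bound : ∀ {n a b} k → (∀ j → n ℕ.≤ j ℕ.* j → k ℕ.≤ j) → n ℕ.≤ a ℕ.* b →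
  k ℕ.+ k ℕ.≤ suc (a ℕ.+ b)
least-root-bound zero _ _ = ℕ.z≤n
least-root-bound {n} {a} {b} (suc m) least n≤ab = ℕₚ.≮⇒≥ λ a+b<2m →
  ℕₚ.1+n≰n (least m (ℕₚ.≤-trans n≤ab (product≤square a b m
    (ℕ.s≤s⁻¹ (ℕ.s≤s⁻¹ (subst (suc (suc (a ℕ.+ b)) ℕ.≤_) (cong suc (ℕₚ.+-suc m m)) a+b<2m))))))

sum-bounds : ∀ {n a b k e f} → e ℕ.+ (suc a ℕ.+ a) ℕ.≤ 3 ℕ.* n → f ℕ.+ (suc b ℕ.+ b) ℕ.≤ 3 ℕ.* n →
  k ℕ.+ k ℕ.≤ suc (a ℕ.+ b) → + (e ℕ.+ f) ℤ.≤ + 6 * + n - + 4 * + k + + 1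
sum-bounds {n} {a} {b} {k} {e} {f} e≤ f≤ 2k≤ = begin
  + (e ℕ.+ f)                             ≡⟨ i≡i+j-j (+ (e ℕ.+ f)) (+ (4 ℕ.* k)) ⟩
  + (e ℕ.+ f ℕ.+ 4 ℕ.* k) - + (4 ℕ.* k)   ≤⟨ ℤₚ.+-monoˡ-≤ (ℤ.- + (4 ℕ.* k)) (ℤ.+≤+ e+f+4k≤6n) ⟩
  + (6 ℕ.* n) - + (4 ℕ.* k)               ≡⟨ cong₂ _-_ (ℤₚ.pos-* 6 n) (ℤₚ.pos-* 4 k) ⟩
  -- The count gives `6n - 4k`; this step weakens it to the stated form.
  + 6 * + n - + 4 * + k                   ≤⟨ ℤₚ.i≤i+j _ (+ 1) ⟩
  + 6 * + n - + 4 * + k + + 1             ∎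
  where
  open ℤₚ.≤-Reasoning
  i≡i+j-j : ∀ i j → i ≡ i + j - j
  i≡i+j-j i j = sym (trans (ℤₚ.+-assoc i j (ℤ.- j)) (trans (cong (_+_ i) (ℤₚ.+-inverseʳ j)) (ℤₚ.+-identityʳ i)))
  regroup : ∀ a b e f → e ℕ.+ f ℕ.+ 2 ℕ.* suc (a ℕ.+ b) ≡ (e ℕ.+ (suc a ℕ.+ a)) ℕ.+ (f ℕ.+ (suc b ℕ.+ b))
  regroup = solve-∀
  4k : ∀ k → 4 ℕ.* k ≡ 2 ℕ.* (k ℕ.+ k)
  4k = solve-∀
  6n : ∀ n → 3 ℕ.* n ℕ.+ 3 ℕ.* n ≡ 6 ℕ.* n
  6n = solve-∀
  e+f+4k≤6n : e ℕ.+ f ℕ.+ 4 ℕ.* k ℕ.≤ 6 ℕ.* n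
  e+f+4k≤6n = ℕₚ.≤-trans
    (ℕₚ.+-monoʳ-≤ (e ℕ.+ f) (ℕₚ.≤-trans (ℕₚ.≤-reflexive (4k k)) (ℕₚ.*-monoʳ-≤ 2 2k≤)))
    (ℕₚ.≤-trans (ℕₚ.≤-reflexive (regroup a b e f))
      (ℕₚ.≤-trans (ℕₚ.+-mono-≤ e≤ f≤) (ℕₚ.≤-reflexive (6n n))))

-- Assembling the edge count.

edges-unique : ∀ {n} (G : SimpleGraph n) → Unique (edges G)
edges-unique {n} G = Uniqueₚ.filter⁺ (λ (v , w) → v Fin.<? w ×-dec Adj? G v w)
  (Uniqueₚ.cartesianProduct⁺ (Uniqueₚ.allFin⁺ n) (Uniqueₚ.allFin⁺ n))

edges-adjacent : ∀ {n} (G : SimpleGraph n) → All (λ (v , w) → v Fin.< w × Adj G v w) (edges G)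
edges-adjacent {n} G =
  Allₚ.all-filter (λ (v , w) → v Fin.<? w ×-dec Adj? G v w) (cartesianProduct (allFin n) (allFin n))

theorem6p4 : ∀ (n : ℕ) → 1 ℕ.≤ n → (G : SimpleGraph n) → IsURVG G →
    + ∣E G ∣ ℤ.≤ + 6 * + n - + 4 * + ⌈√ n ⌉ + + 1
theorem6p4 n 1≤n G (S , disjoint , represents) = decidable-stable (_ ℤₚ.≤? _) λ ¬goal →
  ¬¬-decides (proj₁ ∘ S) λ decidesˣ → ¬¬-decides (proj₂ ∘ S) λ decidesʸ → ¬goal (bound decidesˣ decidesʸ)
  where
  bound : Decides (proj₁ ∘ S) → Decides (proj₂ ∘ S) →
    + ∣E G ∣ ℤ.≤ + 6 * + n - + 4 * + ⌈√ n ⌉ + + 1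
  bound decidesˣ decidesʸ =
    let v₀ = Fin.fromℕ< 1≤n
        X = semiorder (proj₁ ∘ S) decidesˣ
        Y = semiorder (proj₂ ∘ S) decidesʸ
        row , chainˣ , h , h< , h-mono = longest-chain X v₀
        column , chainʸ , k , k< , k-mono = longest-chain Y v₀
        -- An edge visible in both directions enters only one list, so the lengths add up exactly.
        es , fs , ∣es∣+∣fs∣ , (unique-es , _ , horizontal) , (unique-fs , _ , vertical) =
          split {P = λ (v , w) → v Fin.< w × HorizontalBand S v w}
                {Q = λ (v , w) → v Fin.< w × VerticalBand S v w}
            (edges-unique G)
            (All.map (λ (v<w , adj) → Sum.map (v<w ,_) (v<w ,_)
               (Equivalence.to (represents _ _ (Finₚ.<⇒≢ v<w)) adj)) (edges-adjacent G))
        swapped-disjoint : DisjointInteriors (swap ∘ S)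
        swapped-disjoint = λ v≢w p p∈v p∈w → disjoint v≢w (swap p) (swap p∈v) (swap p∈w)
        n≤ab = comparable⇒product-bound Y X (comparable S disjoint decidesˣ decidesʸ)
                 k h k< h< k-mono h-mono
    in subst (λ e → + e ℤ.≤ + 6 * + n - + 4 * + ⌈√ n ⌉ + + 1) ∣es∣+∣fs∣
         (sum-bounds {n} {length column} {length row} {⌈√ n ⌉} {length es} {length fs}
           (horizontal-bound S disjoint decidesˣ decidesʸ unique-es horizontal chainʸ v₀)
           -- Reflection in the diagonal makes vertical bands horizontal, so the chain in `X` pays
           -- for them.
           (horizontal-bound (swap ∘ S) swapped-disjoint decidesʸ decidesˣ unique-fs vertical chainˣ v₀)
           (least-root-bound {n} {length column} {length row} ⌈√ n ⌉ (⌈√⌉-least n) n≤ab))
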